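{- There exists a string family on which $\ell = o(\ell_m)$.
   Context: A string family is an infinite set of finite strings of unbounded length; asymptotic notation on a family refers to strings $w$ of the family with $n=|w|\to\infty$ (with constants uniform over the family). $w[i:j]$ denotes the substring of $w$ from position $i$ to position $j$ (positions start at 1). L-systems: an L-system is a tuple $(\Sigma,\varphi,\tau,s,d,n)$, where $\Sigma$ is a finite alphabet, $\varphi:\Sigma^*\to\Sigma^*$ is a non-erasing monoid endomorphism (each rule $a\to\varphi(a)$, $a\in\Sigma$, has $|\varphi(a)|\ge 1$), $\tau:\Sigma^*\to\Sigma^*$ is a coding (a morphism with $|\tau(a)|=1$ for all $a\in\Sigma$), $s\in\Sigma^+$ is the axiom, and $d\ge 0$, $n\ge 1$ are integers. It generates the unique string $\tau(\varphi^d(s))[1:n]$ of length $n$. It is always assumed that $d=n^{O(1)}$ and $|\Sigma|=n^{O(1)}$ (each value fits in an $O(\log n)$-bit word). The size of the L-system is $\sum_{a\in\Sigma}|\varphi(a)|+|s|+|\Sigma|+2$. The measure $\ell(w)$ is the size of the smallest L-system generating $w$. An L-system is prolongable if there is a symbol $a$ such that $s=a$ and $\varphi(a)=ax$ with $x\neq\varepsilon$ (the empty string). $\ell_m(w)$ is the size of the smallest prolongable L-system generating $w$. -}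

module Defs where

open import Data.Fin.Base using (Fin)
open import Data.List.Base using (List; length; map; concatMap; take; sum; tabulate)
open import Data.List.NonEmpty.Base as List⁺ using (List⁺; [_]; _∷⁺_; toList)
open import Data.Nat.Base using (ℕ; _+_; _*_; _^_; _≤_)
open import Data.Nat.GeneralisedArithmetic using (fold)
open import Data.Product.Base using (_×_; ∃-syntax)
open import Function.Definitions using (Injective)
open import Level using (0ℓ)
open import Relation.Binary.PropositionalEquality.Core using (_≡_)
open import Relation.Unary using (Pred; _∈_)

-- Strings are over a countable supply of symbols; every individual alphabet
-- is a finite subset of it.

Symbol : Set
Symbol = ℕ

String : Set
String = List Symbol

-- The alphabet Σ is the finite set of symbols { name a | a : Fin σ }, so σ = |Σ|.
-- A non-erasing endomorphism and a coding are given by their values on letters.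

record LSystem : Set where
  field
    σ        : ℕ
    name     : Fin σ → Symbol
    name-inj : Injective _≡_ _≡_ name
    φ        : Fin σ → List⁺ (Fin σ)
    τ        : Fin σ → Fin σ
    s        : List⁺ (Fin σ)
    d        : ℕ
    n        : ℕ
    n≥1      : 1 ≤ n

  φ* : List (Fin σ) → List (Fin σ)
  φ* = concatMap (λ a → toList (φ a))

  -- τ(φᵈ(s))
  expansion : List (Fin σ)
  expansion = map τ (fold (toList s) φ* d)

  size : ℕ
  size = sum (tabulate (λ a → List⁺.length (φ a))) + List⁺.length s + σ + 2

-- The condition length w ≡ n matters: take n returns fewer than n symbols
-- when the expansion is shorter than n.

Generates : LSystem → String → Set
Generates L w = length w ≡ n × map name (take n expansion) ≡ w
  where open LSystem L

-- The standing assumption d = n^O(1), |Σ| = n^O(1), for a fixed exponent c.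

PolyBounded : ℕ → LSystem → Set
PolyBounded c L = d ≤ n ^ c × σ ≤ n ^ c
  where open LSystem L

Prolongable : LSystem → Set
Prolongable L = ∃[ a ] s ≡ [ a ] × (∃[ x ] φ a ≡ a ∷⁺ x)
  where open LSystem L

IsLeast : Pred ℕ 0ℓ → ℕ → Set
IsLeast P k = k ∈ P × (∀ j → j ∈ P → k ≤ j)

-- A measure is presented by its graph: μ w k means that μ(w) = k.

Measure : Set₁
Measure = String → ℕ → Set

-- The exponent c is at least 1 in all uses: then every nonempty w is generated
-- by some admissible (prolongable) system, and ℓ c and ℓₘ c are defined at w.

ℓ : ℕ → Measure
ℓ c w = IsLeast λ k →
  ∃[ L ] PolyBounded c L × Generates L w × LSystem.size L ≡ k

ℓₘ : ℕ → Measure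
ℓₘ c w = IsLeast λ k →
  ∃[ L ] PolyBounded c L × Prolongable L × Generates L w × LSystem.size L ≡ k

-- A set of strings of unbounded length is automatically infinite.

record StringFamily : Set₁ where
  field
    members   : Pred String 0ℓ
    unbounded : ∀ m → ∃[ w ] w ∈ members × m ≤ length w

-- μ = o(ν) on F, as |w| → ∞: for every K, eventually μ(w) and ν(w) are defined
-- and K · μ(w) ≤ ν(w).

LittleO : StringFamily → Measure → Measure → Set
LittleO F μ ν =
  ∀ K → ∃[ N ] (∀ w → w ∈ members → N ≤ length w →
    ∃[ x ] ∃[ y ] μ w x × ν w y × K * x ≤ y)
  where open StringFamily F

{-# OPTIONS --safe #-}

-- The family is { 0ᵐ1 : m ≥ 2 }. The system a → a0, 0 → 0, 1 → 1 with axiom a1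
-- and coding a ↦ 0 has size 11 and generates all of these strings, so ℓ ≤ 11.
-- In a prolongable system with axiom a, φᵗ(a) is a prefix of φᵈ(a) for t ≤ d, and
-- every letter of φᵈ(a) already occurs in φᵗ(a) for some t < |Σ|. Hence the first
-- symbol coded as 1 lies within the first |φᵗ(a)| ≤ kᵏ positions, k being the size
-- of the system, so that a system generating 0ᵐ1 satisfies m < kᵏ.
-- That the two minima exist is shown constructively by a finite search.

module Submission where

open import Defs
open import Data.Fin.Base as Fin using (Fin; zero; suc; toℕ; fromℕ<; join; splitAt)
open import Data.Fin.Patterns using (0F; 1F; 2F)
import Data.Fin.Properties as Fin
open import Data.List.Base
  using (List; []; _∷_; _++_; length; map; take; tabulate; replicate)
open import Data.List.Membership.DecPropositional using (_∈?_)
open import Data.List.Membership.Propositional using (_∈_; find; lose)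
import Data.List.Membership.Propositional.Properties as List
open import Data.List.NonEmpty.Base as List⁺ using (List⁺; _∷_; _∷⁺_; toList)
import Data.List.Properties as List
open import Data.List.Relation.Unary.All as All using (All; []; _∷_)
import Data.List.Relation.Unary.All.Properties as All
open import Data.List.Relation.Unary.Any using (here; there)
open import Data.Nat.Base
open import Data.Nat.GeneralisedArithmetic using (fold)
open import Data.Nat.Induction using (<-rec)
open import Data.Nat.ListAction using (sum)
open import Data.Nat.Properties
open import Data.Product.Base using (Σ; ∃; ∃-syntax; _×_; _,_; proj₁; proj₂)
open import Data.Sum.Base using (_⊎_; inj₁; inj₂)
open import Data.Sum.Properties using (inj₁-injective)
open import Data.Unit.Base using (⊤; tt)
open import Data.Vec.Base as Vec using (Vec; []; _∷_; lookup)
import Data.Vec.Properties as Vec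
open import Function.Base using (_∘_; const)
open import Function.Definitions using (Injective)
open import Level using (0ℓ)
open import Relation.Binary.PropositionalEquality
open import Relation.Nullary using (Dec; yes; no; contradiction)
open import Relation.Nullary.Decidable using (map′; _×-dec_; _→-dec_)
open import Relation.Unary using (Pred; Decidable)

-- Minima and exhaustive search

-- Descent: a bounded search below a witness either finds a smaller one, from which to continue, or
-- certifies the current one as least.
IsLeast-exists : ∀ {P : Pred ℕ 0ℓ} → Decidable P → ∀ {k} → P k → ∃ (IsLeast P)
IsLeast-exists {P} P? {k} = <-rec (λ k → P k → ∃ (IsLeast P)) step k
  where
  step : ∀ k → (∀ {j} → j < k → P j → ∃ (IsLeast P)) → P k → ∃ (IsLeast P)
  step k rec Pk with anyUpTo? P? k
  ... | yes (j , j<k , Pj) = rec j<k Pj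
  ... | no  ∄j             = k , Pk , λ j Pj → ≮⇒≥ (λ j<k → ∄j (j , j<k , Pj))

-- Finiteness expressed as searchability, which passes to products, vectors and bounded lists
-- without any enumeration of elements.
Exhaustible : Set → Set₁
Exhaustible A = ∀ {P : Pred A 0ℓ} → Decidable P → Dec (∃ P)

exhaustible-× : ∀ {A B} → Exhaustible A → Exhaustible B → Exhaustible (A × B)
exhaustible-× any-A? any-B? P? =
  map′ (λ (a , b , p) → (a , b) , p) (λ ((a , b) , p) → a , b , p)
       (any-A? λ a → any-B? λ b → P? (a , b))

exhaustible-Vec : ∀ {A} → Exhaustible A → ∀ n → Exhaustible (Vec A n)
exhaustible-Vec any-A? zero    P? = map′ ([] ,_) (λ { ([] , p) → p }) (P? [])
exhaustible-Vec any-A? (suc n) P? =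
  map′ (λ (x , xs , p) → x ∷ xs , p) (λ { (x ∷ xs , p) → x , xs , p })
       (any-A? λ x → exhaustible-Vec any-A? n λ xs → P? (x ∷ xs))

data List≤ (A : Set) : ℕ → Set where
  []  : ∀ {n} → List≤ A n
  _∷_ : ∀ {n} → A → List≤ A n → List≤ A (suc n)

fromList≤ : ∀ {A n} → List≤ A n → List A
fromList≤ []       = []
fromList≤ (x ∷ xs) = x ∷ fromList≤ xs

fromList≤-surjective : ∀ {A n} (xs : List A) → length xs ≤ n →
                       ∃[ ys ] fromList≤ {A} {n} ys ≡ xs
fromList≤-surjective []       _         = [] , refl
fromList≤-surjective (x ∷ xs) (s≤s len) with fromList≤-surjective xs len
... | ys , eq = x ∷ ys , cong (x ∷_) eq

exhaustible-List≤ : ∀ {A} → Exhaustible A → ∀ n → Exhaustible (List≤ A n)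
exhaustible-List≤ any-A? zero    P? = map′ ([] ,_) (λ { ([] , p) → p }) (P? [])
exhaustible-List≤ any-A? (suc n) P? with P? []
... | yes p = yes ([] , p)
... | no ¬p =
  map′ (λ (x , xs , q) → x ∷ xs , q)
       (λ { ([] , q) → contradiction q ¬p ; (x ∷ xs , q) → x , xs , q })
       (any-A? λ x → exhaustible-List≤ any-A? n λ xs → P? (x ∷ xs))

List⁺≤ : Set → ℕ → Set
List⁺≤ A n = A × List≤ A n

fromList⁺≤ : ∀ {A n} → List⁺≤ A n → List⁺ A
fromList⁺≤ (x , xs) = x ∷ fromList≤ xs

fromList⁺≤-surjective : ∀ {A n} (xs : List⁺ A) → List⁺.length xs ≤ n →
                        ∃[ ys ] fromList⁺≤ {A} {n} ys ≡ xs
fromList⁺≤-surjective (x ∷ xs) len with fromList≤-surjective xs (≤-trans (n≤1+n _) len)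
... | ys , eq = (x , ys) , cong (x ∷_) eq

-- Size bounds and changes of presentation

≤-sum-tabulate : ∀ {n} (f : Fin n → ℕ) i → f i ≤ sum (tabulate f)
≤-sum-tabulate f zero    = m≤m+n _ _
≤-sum-tabulate f (suc i) = ≤-trans (≤-sum-tabulate (f ∘ suc) i) (m≤n+m _ _)

module _ (L : LSystem) where
  open LSystem L

  private
    Φ = sum (tabulate (λ a → List⁺.length (φ a)))

  φ-length≤size : ∀ a → List⁺.length (φ a) ≤ size
  φ-length≤size a = begin
    List⁺.length (φ a)  ≤⟨ ≤-sum-tabulate (λ a → List⁺.length (φ a)) a ⟩
    Φ                   ≤⟨ m≤m+n _ _ ⟩
    Φ + _               ≤⟨ m≤m+n _ _ ⟩
    Φ + _ + _           ≤⟨ m≤m+n _ _ ⟩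
    size                ∎
    where open ≤-Reasoning

  s-length≤size : List⁺.length s ≤ size
  s-length≤size = ≤-trans (m≤n+m _ Φ) (≤-trans (m≤m+n _ _) (m≤m+n _ _))

  σ<size : σ < size
  σ<size = begin-strict
    σ                            ≤⟨ m≤n+m _ _ ⟩
    Φ + List⁺.length s + σ       <⟨ m<m+n _ z<s ⟩
    size                         ∎
    where open ≤-Reasoning

  -- Rules and coding read back from finite tables agree with the original functions only pointwise,
  -- and the names are altered; a system and its table form differ in just these fields.
  variant : (ν : Fin σ → Symbol) → Injective _≡_ _≡_ ν →
            (Fin σ → List⁺ (Fin σ)) → (Fin σ → Fin σ) → LSystem
  variant ν ν-inj φ′ τ′ = record L { name = ν ; name-inj = ν-inj ; φ = φ′ ; τ = τ′ }

  module _ {ν : Fin σ → Symbol} (ν-inj : Injective _≡_ _≡_ ν)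
           {φ′ : Fin σ → List⁺ (Fin σ)} {τ′ : Fin σ → Fin σ}
           (φ′≗φ : φ′ ≗ φ) (τ′≗τ : τ′ ≗ τ) where

    private
      L′ = variant ν ν-inj φ′ τ′

    variant-expansion : LSystem.expansion L′ ≡ expansion
    variant-expansion = trans (List.map-cong τ′≗τ _) (cong (map τ) (iterates d))
      where
      iterates : ∀ t → fold (toList s) (LSystem.φ* L′) t ≡ fold (toList s) φ* t
      iterates zero    = refl
      iterates (suc t) =
        trans (List.concatMap-cong (cong toList ∘ φ′≗φ) (fold (toList s) (LSystem.φ* L′) t))
              (cong φ* (iterates t))

    variant-size : LSystem.size L′ ≡ size
    variant-size =
      cong (λ x → x + List⁺.length s + σ + 2)
           (cong sum (List.tabulate-cong (cong List⁺.length ∘ φ′≗φ)))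

-- Letters named outside of w can be renamed freely, so the search for a naming can be
-- confined to a finite range.

module _ {σ} (name : Fin σ → Symbol) (b : ℕ) where

  private
    tag : Fin σ → Fin b ⊎ Fin σ
    tag a with name a <? b
    ... | yes p = inj₁ (fromℕ< p)
    ... | no  _ = inj₂ a

    tag-injective : Injective _≡_ _≡_ name → Injective _≡_ _≡_ tag
    tag-injective inj {x} {y} eq with name x <? b | name y <? b
    tag-injective inj {x} {y} eq   | yes p | yes q =
      inj (Fin.fromℕ<-injective _ _ p q (inj₁-injective eq))
    tag-injective inj {x} {y} ()   | yes p | no  _
    tag-injective inj {x} {y} ()   | no  _ | yes _
    tag-injective inj {x} {y} refl | no  _ | no  _ = refl

  bounded-name : Fin σ → Fin (b + σ)
  bounded-name a = join b σ (tag a)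

  bounded-name-injective : Injective _≡_ _≡_ name → Injective _≡_ _≡_ bounded-name
  bounded-name-injective inj {x} {y} eq = tag-injective inj (begin
    tag x                       ≡⟨ Fin.splitAt-join b σ (tag x) ⟨
    splitAt b (bounded-name x)  ≡⟨ cong (splitAt b) eq ⟩
    splitAt b (bounded-name y)  ≡⟨ Fin.splitAt-join b σ (tag y) ⟩
    tag y                       ∎)
    where open ≡-Reasoning

  bounded-name-agrees : ∀ a → name a < b → toℕ (bounded-name a) ≡ name a
  bounded-name-agrees a p with name a <? b
  ... | yes q = trans (Fin.toℕ-↑ˡ (fromℕ< q) σ) (Fin.toℕ-fromℕ< q)
  ... | no ¬p = contradiction p ¬p

-- Deciding whether a word has a system of a given size

-- The graphs of ℓ and ℓₘ are both of the form IsLeast (SizeOf Q c w).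

SizeOf : Pred LSystem 0ℓ → ℕ → String → Pred ℕ 0ℓ
SizeOf Q c w k = ∃[ L ] PolyBounded c L × Q L × Generates L w × LSystem.size L ≡ k

module _ {Q : Pred LSystem 0ℓ} (Q? : Decidable Q)
  (Q-variant : ∀ L {ν} (ν-inj : Injective _≡_ _≡_ ν) {φ′ τ′} →
               φ′ ≗ LSystem.φ L → τ′ ≗ LSystem.τ L → Q L → Q (variant L ν ν-inj φ′ τ′))
  (c : ℕ) {w : String} (w≥1 : 1 ≤ length w) {b : ℕ} (w<b : All (_< b) w) (k : ℕ) where

  private
    -- The components are, in order, the names, the rules, the coding and the axiom.
    Tables : ℕ → Set
    Tables σ = Vec (Fin (b + σ)) σ × Vec (List⁺≤ (Fin σ) k) σ × Vec (Fin σ) σ ×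
               List⁺≤ (Fin σ) k

    exhaustible-Tables : ∀ σ → Exhaustible (Tables σ)
    exhaustible-Tables σ =
      exhaustible-× (exhaustible-Vec Fin.any? σ)
        (exhaustible-× (exhaustible-Vec any-List⁺≤? σ)
          (exhaustible-× (exhaustible-Vec Fin.any? σ) any-List⁺≤?))
      where
      any-List⁺≤? : Exhaustible (List⁺≤ (Fin σ) k)
      any-List⁺≤? = exhaustible-× Fin.any? (exhaustible-List≤ Fin.any? k)

    -- Its names are irrelevant; they stand in for those of the first table, whose
    -- injectivity is yet to be tested.
    skeleton : ∀ σ → ℕ → Tables σ → LSystem
    skeleton σ d (_ , φs , τs , s) = record
      { σ        = σ
      ; name     = toℕ
      ; name-inj = Fin.toℕ-injective
      ; φ        = fromList⁺≤ ∘ lookup φs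
      ; τ        = lookup τs
      ; s        = fromList⁺≤ s
      ; d        = d
      ; n        = length w
      ; n≥1      = w≥1
      }

    names : ∀ {σ} → Tables σ → Fin σ → Symbol
    names (νs , _) = toℕ ∘ lookup νs

    Valid : ∀ σ → ℕ → Pred (Tables σ) 0ℓ
    Valid σ d t =
      (∀ x y → names t x ≡ names t y → x ≡ y) ×
      PolyBounded c S × Q S ×
      map (names t) (take (length w) (LSystem.expansion S)) ≡ w ×
      LSystem.size S ≡ k
      where S = skeleton σ d t

    valid? : ∀ σ d → Decidable (Valid σ d)
    valid? σ d t =
      (Fin.all? λ x → Fin.all? λ y → (names t x ≟ names t y) →-dec (x Fin.≟ y)) ×-dec
      ((d ≤? length w ^ c) ×-dec (σ ≤? length w ^ c)) ×-dec Q? (skeleton σ d t) ×-dec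
      List.≡-dec _≟_ _ w ×-dec
      (_ ≟ k)

    -- The search runs below strict bounds: `σ` is less than any size, while `d` may equal
    -- `length w ^ c`, hence the successor.
    Found : Set
    Found = ∃[ σ ] σ < k × ∃[ d ] d < suc (length w ^ c) × ∃ (Valid σ d)

    sound : Found → SizeOf Q c w k
    sound (σ , _ , d , _ , t , inj , poly , q , gen , size≡k) =
      variant S (names t) inj′ (LSystem.φ S) (LSystem.τ S) , poly ,
      Q-variant S inj′ (λ _ → refl) (λ _ → refl) q , (refl , gen) , size≡k
      where
      S = skeleton σ d t
      inj′ : Injective _≡_ _≡_ (names t)
      inj′ {x} {y} = inj x y

    complete : SizeOf Q c w k → Found
    complete (L , (d≤ , σ≤) , q , (refl , gen) , size≡k)
      -- Identifying the axiom and the proof of `n≥1` with those of the skeleton makes the skeleton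
      -- definitionally a `variant` of `L`.
      with fromList⁺≤-surjective {n = k} (LSystem.s L)
             (≤-trans (s-length≤size L) (≤-reflexive size≡k))
         | ≤-irrelevant (LSystem.n≥1 L) w≥1
    ... | s′ , refl | refl =
      σ , <-≤-trans (σ<size L) (≤-reflexive size≡k) , d , s≤s d≤ , t ,
      inj , (d≤ , σ≤) , Q-variant L Fin.toℕ-injective φ≗ τ≗ q , gen′ ,
      trans (variant-size L Fin.toℕ-injective φ≗ τ≗) size≡k
      where
      open LSystem L
      encode : ∀ a → ∃[ ys ] fromList⁺≤ {n = k} ys ≡ φ a
      encode a = fromList⁺≤-surjective (φ a) (≤-trans (φ-length≤size L a) (≤-reflexive size≡k))

      νs = Vec.tabulate (bounded-name name b)
      φs = Vec.tabulate (proj₁ ∘ encode)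
      τs = Vec.tabulate τ

      t : Tables σ
      t = νs , φs , τs , s′

      φ≗ : fromList⁺≤ ∘ lookup φs ≗ φ
      φ≗ a = trans (cong fromList⁺≤ (Vec.lookup∘tabulate (proj₁ ∘ encode) a))
                   (proj₂ (encode a))

      τ≗ : lookup τs ≗ τ
      τ≗ = Vec.lookup∘tabulate τ

      ν≗ : lookup νs ≗ bounded-name name b
      ν≗ = Vec.lookup∘tabulate (bounded-name name b)

      inj : ∀ x y → names t x ≡ names t y → x ≡ y
      inj x y eq = bounded-name-injective name b name-inj
        (trans (sym (ν≗ x)) (trans (Fin.toℕ-injective eq) (ν≗ y)))

      -- Letters in the generated prefix are named by symbols of `w`, so `bounded-name` leaves their
      -- names unchanged.
      prefix<b : All (λ a → name a < b) (take (length w) expansion)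
      prefix<b = All.map⁻ (subst (All (_< b)) (sym gen) w<b)

      gen′ : map (names t) (take (length w)
               (LSystem.expansion (skeleton σ d t))) ≡ w
      gen′ = begin
        map (names t) (take (length w) (LSystem.expansion (skeleton σ d t)))
          ≡⟨ cong (map (names t) ∘ take (length w))
                  (variant-expansion L Fin.toℕ-injective φ≗ τ≗) ⟩
        map (names t) (take (length w) expansion)
          ≡⟨ List.map-cong-local (All.map (λ {a} p →
               trans (cong toℕ (ν≗ a)) (bounded-name-agrees name b a p)) prefix<b) ⟩
        map name (take (length w) expansion)
          ≡⟨ gen ⟩
        w ∎
        where open ≡-Reasoning

  -- Only finitely many candidates matter: size `k` bounds the alphabet, every rule and the axiom,
  -- `PolyBounded` bounds `d`, and renaming bounds the names.
  sizeOf? : Dec (SizeOf Q c w k)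
  sizeOf? = map′ sound complete
    (anyUpTo? (λ σ → anyUpTo? (λ d → exhaustible-Tables σ (valid? σ d)) _) k)

prolongable? : Decidable Prolongable
prolongable? L = Fin.any? λ a → singleton? a s ×-dec starts-with? a (φ a)
  where
  open LSystem L
  singleton? : ∀ a (xs : List⁺ (Fin σ)) → Dec (xs ≡ List⁺.[ a ])
  singleton? a (x ∷ [])    = map′ (λ { refl → refl }) (λ { refl → refl }) (x Fin.≟ a)
  singleton? a (x ∷ _ ∷ _) = no λ ()

  starts-with? : ∀ a (xs : List⁺ (Fin σ)) → Dec (∃[ x ] xs ≡ a ∷⁺ x)
  starts-with? a (x ∷ [])     = no λ { (_ ∷ _ , ()) }
  starts-with? a (x ∷ y ∷ ys) =
    map′ (λ { refl → y ∷ ys , refl }) (λ { (_ ∷ _ , refl) → refl }) (x Fin.≟ a)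

-- Growth, prefixes and first occurrences in the iterates

module _ (L : LSystem) where
  open LSystem L

  private
    iter : ℕ → List (Fin σ)
    iter = fold (toList s) φ*

  iterate-length : ∀ {k} → (∀ a → List⁺.length (φ a) ≤ k) →
                   ∀ t → length (iter t) ≤ k ^ t * List⁺.length s
  iterate-length {k} φ≤k zero    = ≤-reflexive (sym (+-identityʳ _))
  iterate-length {k} φ≤k (suc t) = begin
    length (φ* (iter t))            ≤⟨ φ*-length (iter t) ⟩
    k * length (iter t)             ≤⟨ *-monoʳ-≤ k (iterate-length φ≤k t) ⟩
    k * (k ^ t * List⁺.length s)    ≡⟨ *-assoc k _ _ ⟨
    k ^ suc t * List⁺.length s      ∎
    where
    open ≤-Reasoning
    φ*-length : ∀ xs → length (φ* xs) ≤ k * length xs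
    φ*-length []       = z≤n
    φ*-length (x ∷ xs) = begin
      length (φ* (x ∷ xs))                  ≡⟨ List.length-++ (toList (φ x)) ⟩
      List⁺.length (φ x) + length (φ* xs)   ≤⟨ +-mono-≤ (φ≤k x) (φ*-length xs) ⟩
      k + k * length xs                     ≡⟨ *-suc k (length xs) ⟨
      k * suc (length xs)                   ∎

  -- The axiom is a prefix of its own image, and a morphism preserves prefixes, so each iterate is a
  -- prefix of the next.
  iterate-prefix : Prolongable L → ∀ {t u} → t ≤ u → ∃[ ys ] iter u ≡ iter t ++ ys
  iterate-prefix (a , refl , x , φa≡ax) t≤u = go (≤⇒≤′ t≤u)
    where
    step : ∀ t → ∃[ ys ] iter (suc t) ≡ iter t ++ ys
    step zero rewrite φa≡ax = toList x ++ [] , refl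
    step (suc t) with step t
    ... | ys , eq = φ* ys , trans (cong φ* eq) (List.concatMap-++ _ (iter t) ys)

    go : ∀ {t u} → t ≤′ u → ∃[ ys ] iter u ≡ iter t ++ ys
    go {t} ≤′-refl = [] , sym (List.++-identityʳ (iter t))
    go {t} (≤′-step {u} p) with go p | step u
    ... | ys , eq | zs , eq′ = ys ++ zs ,
      trans eq′ (trans (cong (_++ zs) eq) (List.++-assoc (iter t) ys zs))

  FirstOccurs : Fin σ → Pred ℕ 0ℓ
  FirstOccurs c = IsLeast (λ t → c ∈ iter t)

  -- A letter first occurring at time t + 1 is produced by one first occurring at
  -- time t; so there are letters first occurring at each earlier time, and these
  -- are distinct.
  firstOccurs-earlier : ∀ t {c} → FirstOccurs c t → ∀ {i} → i ≤ t → ∃[ b ] FirstOccurs b i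
  firstOccurs-earlier t first = go first ∘ ≤⇒≤′
    where
    predecessor : ∀ {t c} → FirstOccurs c (suc t) → ∃[ b ] FirstOccurs b t
    predecessor {t} {c} (c∈ , least) with find (List.∈-concatMap⁻ (toList ∘ φ) {xs = iter t} c∈)
    ... | b , b∈ , c∈φb = b , b∈ , λ j b∈j → s≤s⁻¹ (least (suc j)
      (List.∈-concatMap⁺ (toList ∘ φ) (lose b∈j c∈φb)))

    go : ∀ {t c} → FirstOccurs c t → ∀ {i} → i ≤′ t → ∃[ b ] FirstOccurs b i
    go first ≤′-refl     = _ , first
    go first (≤′-step p) = go (proj₂ (predecessor first)) p

  -- Pigeonhole: choosing a letter for each of the `suc t` times from 0 to `t` injects these times
  -- into the alphabet.
  firstOccurs<σ : ∀ {t c} → FirstOccurs c t → t < σ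
  firstOccurs<σ {t} first = Fin.injective⇒≤ {f = proj₁ ∘ at} at-injective
    where
    at : (i : Fin (suc t)) → ∃[ b ] FirstOccurs b (toℕ i)
    at i = firstOccurs-earlier t first (Fin.toℕ≤pred[n] i)

    at-injective : Injective _≡_ _≡_ (proj₁ ∘ at)
    at-injective {i} {j} eq with at i | at j
    at-injective {i} {j} refl | _ , b∈i , leastᵢ | _ , b∈j , leastⱼ =
      Fin.toℕ-injective (≤-antisym (leastᵢ _ b∈j) (leastⱼ _ b∈i))

-- Lower bound for prolongable systems

0ᵐ1 : ℕ → String
0ᵐ1 m = replicate m 0 ++ 1 ∷ []

length-0ᵐ1 : ∀ m → length (0ᵐ1 m) ≡ suc m
length-0ᵐ1 zero    = refl
length-0ᵐ1 (suc m) = cong suc (length-0ᵐ1 m)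

-- The first `m` symbols of `u ++ v` are 0, so a 1 in `u` can only lie after them.
take-0ᵐ1⇒< : ∀ m (u : String) {v} → take (suc m) (u ++ v) ≡ 0ᵐ1 m → 1 ∈ u → m < length u
take-0ᵐ1⇒< zero    (x ∷ u) eq _  = z<s
take-0ᵐ1⇒< (suc m) (x ∷ u) eq 1∈ with List.∷-injective eq | 1∈
... | refl , eq′ | there 1∈u = s<s (take-0ᵐ1⇒< m u eq′ 1∈u)

prolongable-generates-0ᵐ1 : ∀ L {m} → Prolongable L → Generates L (0ᵐ1 m) →
                            m < LSystem.size L ^ LSystem.size L
prolongable-generates-0ᵐ1 L {m} pro@(_ , refl , _) (refl , gen) = let open ≤-Reasoning in begin-strict
  m                        <⟨ m<prefix ⟩
  length (map f (iter t))  ≡⟨ List.length-map f (iter t) ⟩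
  length (iter t)          ≤⟨ iterate-length L (φ-length≤size L) t ⟩
  -- The factor 1 is the length of the axiom, a single letter by prolongability.
  size ^ t * 1             ≡⟨ *-identityʳ _ ⟩
  size ^ t                 ≤⟨ ^-monoʳ-≤ size {{>-nonZero (≤-<-trans z≤n (σ<size L))}} t≤size ⟩
  size ^ size              ∎
  where
  open LSystem L
  iter = fold (toList s) φ*
  f = name ∘ τ

  gen-f : take (suc m) (map f (iter d)) ≡ 0ᵐ1 m
  gen-f = begin
    take (suc m) (map f (iter d))              ≡⟨ cong (take (suc m)) (List.map-∘ (iter d)) ⟩
    take (suc m) (map name expansion)          ≡⟨ List.take-map (suc m) expansion ⟩
    map name (take (suc m) expansion)
      ≡⟨ cong (λ n → map name (take n expansion)) (length-0ᵐ1 m) ⟨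
    map name (take (length (0ᵐ1 m)) expansion) ≡⟨ gen ⟩
    0ᵐ1 m                                      ∎
    where open ≡-Reasoning

  1∈ : 1 ∈ map f (iter d)
  1∈ = subst (1 ∈_) (List.take++drop≡id (suc m) (map f (iter d)))
    (List.∈-++⁺ˡ (subst (1 ∈_) (sym gen-f) (List.∈-++⁺ʳ (replicate m 0) (here refl))))

  occurrence = List.∈-map⁻ f 1∈
  b = proj₁ occurrence

  b∈ : b ∈ iter d
  b∈ = proj₁ (proj₂ occurrence)

  first : ∃ (FirstOccurs L b)
  first = IsLeast-exists (λ t → _∈?_ Fin._≟_ b (iter t)) {d} b∈

  t = proj₁ first

  t≤size : t ≤ size
  t≤size = <⇒≤ (<-trans (firstOccurs<σ L (proj₂ first)) (σ<size L))

  prefix : ∃[ ys ] iter d ≡ iter t ++ ys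
  -- Minimality gives `t ≤ d`, since `b` occurs at time `d`.
  prefix = iterate-prefix L pro (proj₂ (proj₂ first) d b∈)

  m<prefix : m < length (map f (iter t))
  m<prefix = take-0ᵐ1⇒< m (map f (iter t)) {map f (proj₁ prefix)}
    (trans (cong (take (suc m)) (sym (trans (cong (map f) (proj₂ prefix))
                                            (List.map-++ f (iter t) (proj₁ prefix))))) gen-f)
    (subst (_∈ map f (iter t)) (sym (proj₂ (proj₂ occurrence)))
           (List.∈-map⁺ f (proj₁ (proj₂ first))))

-- Explicit systems for the words of the family

0ʲ1 : ℕ → List (Fin 3)
0ʲ1 j = replicate j 0F ++ 1F ∷ []

-- The letters 0, 1, a are 0F, 1F, 2F.

module Extender (u : List (Fin 3)) (s : List⁺ (Fin 3)) (d j : ℕ) where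

  -- A common template: axiom a1 with `u` = 0 adds one 0 per step and gives the small system, while
  -- axiom a with `u` = 0ʲ1 gives a prolongable one.
  extender : LSystem
  extender = record
    { σ        = 3
    ; name     = toℕ
    ; name-inj = Fin.toℕ-injective
    ; φ        = λ { 0F → List⁺.[ 0F ] ; 1F → List⁺.[ 1F ] ; 2F → 2F ∷ u }
    ; τ        = λ { 0F → 0F ; 1F → 1F ; 2F → 0F }
    ; s        = s
    ; d        = d
    ; n        = length (0ᵐ1 (suc j))
    ; n≥1      = s≤s z≤n
    }

  open LSystem extender using (φ*; τ; n; expansion)

  φ*-0ʲ1 : ∀ i → φ* (0ʲ1 i) ≡ 0ʲ1 i
  φ*-0ʲ1 zero    = refl
  φ*-0ʲ1 (suc i) = cong (0F ∷_) (φ*-0ʲ1 i)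

  extender-generates : fold (toList s) φ* d ≡ 2F ∷ 0ʲ1 j → Generates extender (0ᵐ1 (suc j))
  extender-generates eq = refl , (begin
    map toℕ (take n expansion)              ≡⟨ List.take-map n expansion ⟨
    take n (map toℕ expansion)              ≡⟨ cong (take n ∘ map toℕ ∘ map τ) eq ⟩
    -- The leading letter a is coded as 0, which accounts for the `suc j` zeros.
    take n (0 ∷ map toℕ (map τ (0ʲ1 j)))    ≡⟨ cong (take n ∘ (0 ∷_)) (decode j) ⟩
    take n (0ᵐ1 (suc j))                    ≡⟨ List.take-all n _ ≤-refl ⟩
    0ᵐ1 (suc j)                             ∎)
    where
    open ≡-Reasoning
    decode : ∀ i → map toℕ (map τ (0ʲ1 i)) ≡ 0ᵐ1 i
    decode zero    = refl
    decode (suc i) = cong (0 ∷_) (decode i)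

  extender-polyBounded : ∀ {c} → 1 ≤ c → 1 ≤ j → d ≤ j → PolyBounded c extender
  extender-polyBounded {c} c≥1 j≥1 d≤j =
    -- For the three letters to fit below `n`, which is 2 + j, `j` has to be positive; hence the
    -- family starts with two zeros.
    ≤-trans d≤j (≤-trans (m≤n+m j 2) 2+j≤nᶜ) , ≤-trans (s≤s (s≤s j≥1)) 2+j≤nᶜ
    where
    open ≤-Reasoning
    2+j≤nᶜ : 2 + j ≤ n ^ c
    2+j≤nᶜ = begin
      2 + j    ≡⟨ length-0ᵐ1 (suc j) ⟨
      n        ≡⟨ *-identityʳ n ⟨
      n ^ 1    ≤⟨ ^-monoʳ-≤ n c≥1 ⟩
      n ^ c    ∎

open Extender

0ᵐ1-size≤11 : ∀ {c j} → 1 ≤ c → 1 ≤ j → SizeOf (const ⊤) c (0ᵐ1 (suc j)) 11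
0ᵐ1-size≤11 {j = j} c≥1 j≥1 =
  extender u s j j , extender-polyBounded u s j j c≥1 j≥1 ≤-refl , tt ,
  -- The size is 4 for the rules, 2 for the axiom, 3 for the alphabet and the constant 2.
  extender-generates u s j j (iterates j) , refl
  where
  u = 0F ∷ []
  s = 2F ∷ 1F ∷ []
  iterates : ∀ i → fold (toList s) (LSystem.φ* (extender u s j j)) i ≡ 2F ∷ 0ʲ1 i
  iterates zero    = refl
  iterates (suc i) rewrite iterates i = cong (λ x → 2F ∷ 0F ∷ x) (φ*-0ʲ1 u s j j i)

-- Any size will do here, as this only starts the search for the minimum: the rule of a holds nearly
-- the whole word and is applied once.
0ᵐ1-prolongable : ∀ {c j} → 1 ≤ c → 1 ≤ j → ∃ (SizeOf Prolongable c (0ᵐ1 (suc j)))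
0ᵐ1-prolongable {j = zero}      _   ()
0ᵐ1-prolongable {j = j@(suc i)} c≥1 j≥1 =
  _ , extender u s 1 j , extender-polyBounded u s 1 j c≥1 j≥1 j≥1 ,
  (2F , refl , 0F ∷ 0ʲ1 i , refl) ,
  extender-generates u s 1 j (cong (2F ∷_) (List.++-identityʳ u)) , refl
  where
  u = 0ʲ1 j
  s = List⁺.[ 2F ]

-- Existence of both measures and their ratio

0ᵐ1<2 : ∀ m → All (_< 2) (0ᵐ1 m)
0ᵐ1<2 zero    = s≤s (s≤s z≤n) ∷ []
0ᵐ1<2 (suc m) = s≤s z≤n ∷ 0ᵐ1<2 m

ℓ-0ᵐ1 : ∀ {c j} → 1 ≤ c → 1 ≤ j → ∃[ x ] ℓ c (0ᵐ1 (suc j)) x × x ≤ 11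
ℓ-0ᵐ1 {c} {j} c≥1 j≥1 = proj₁ least , drop-⊤ (proj₂ least) , proj₂ (proj₂ least) 11 size11
  where
  size11 = 0ᵐ1-size≤11 c≥1 j≥1

  least : ∃ (IsLeast (SizeOf (const ⊤) c (0ᵐ1 (suc j))))
  least = IsLeast-exists (sizeOf? (λ _ → yes tt) (λ _ _ _ _ _ → tt) c (s≤s z≤n) (0ᵐ1<2 (suc j)))
                         size11

  drop-⊤ : ∀ {w x} → IsLeast (SizeOf (const ⊤) c w) x → ℓ c w x
  drop-⊤ ((L , poly , _ , gen-size) , least) =
    (L , poly , gen-size) , λ k (L , poly , gen-size) → least k (L , poly , tt , gen-size)

ℓₘ-0ᵐ1 : ∀ {c j} → 1 ≤ c → 1 ≤ j → ∃ (ℓₘ c (0ᵐ1 (suc j)))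
ℓₘ-0ᵐ1 {c} {j} c≥1 j≥1 =
  IsLeast-exists (sizeOf? prolongable? prolongable-variant c (s≤s z≤n) (0ᵐ1<2 (suc j)))
                 (proj₂ (0ᵐ1-prolongable c≥1 j≥1))
  where
  prolongable-variant : ∀ L {ν} (ν-inj : Injective _≡_ _≡_ ν) {φ′ τ′} →
    φ′ ≗ LSystem.φ L → τ′ ≗ LSystem.τ L → Prolongable L → Prolongable (variant L ν ν-inj φ′ τ′)
  prolongable-variant L _ φ′≗φ _ (a , s≡a , x , eq) = a , s≡a , x , trans (φ′≗φ a) eq

0ᵐ1-family : StringFamily
0ᵐ1-family = record
  { members   = λ w → ∃[ i ] w ≡ 0ᵐ1 (2 + i)
  ; unbounded = λ m → 0ᵐ1 (2 + m) , (m , refl) ,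
      ≤-trans (m≤n+m m 3) (≤-reflexive (sym (length-0ᵐ1 (2 + m))))
  }

lemma5 : Σ StringFamily (λ F → ∀ (c : ℕ) → 1 ≤ c → LittleO F (ℓ c) (ℓₘ c))
lemma5 = 0ᵐ1-family , λ c c≥1 K → suc (B K) , λ { .(0ᵐ1 (2 + i)) (i , refl) B<len →
    let x , ℓx , x≤11 = ℓ-0ᵐ1 c≥1 (s≤s z≤n)
        y , ℓₘy       = ℓₘ-0ᵐ1 c≥1 (s≤s z≤n)
        -- The word 0ᵐ1 has length m + 1, so the threshold `suc (B K)` on lengths means `B K ≤ m`.
        B≤2+i         = s≤s⁻¹ (≤-trans B<len (≤-reflexive (length-0ᵐ1 (2 + i))))
    in x , y , ℓx , ℓₘy , ratio K {c} x≤11 ℓₘy B≤2+i }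
  where
  -- If y < K * x with x ≤ 11, then y is below K * 11 and `y ^ y ≤ B K`; the successor keeps the
  -- base positive, so that the power is monotone in its exponent.
  B : ℕ → ℕ
  B K = suc (K * 11) ^ suc (K * 11)

  ratio : ∀ K {c m x y} → x ≤ 11 → ℓₘ c (0ᵐ1 m) y → B K ≤ m → K * x ≤ y
  ratio K {m = m} {x} {y} x≤11 ((L , _ , pro , gen , refl) , _) B≤m =
    ≮⇒≥ λ y<Kx → <-irrefl refl (begin-strict
      B K                   ≤⟨ B≤m ⟩
      m                     <⟨ prolongable-generates-0ᵐ1 L pro gen ⟩
      y ^ y                 ≤⟨ ^-monoˡ-≤ y (y≤ y<Kx) ⟩
      suc (K * 11) ^ y      ≤⟨ ^-monoʳ-≤ (suc (K * 11)) (y≤ y<Kx) ⟩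
      B K                   ∎)
    where
    open ≤-Reasoning
    y≤ : y < K * x → y ≤ suc (K * 11)
    y≤ y<Kx = ≤-trans (<⇒≤ y<Kx) (≤-trans (*-monoʳ-≤ K x≤11) (n≤1+n _))
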